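{- For every integer $k\ge 2$, the infinite product $C_k$ converges and $0<C_k<1$. Furthermore, for every integer $k\ge 2$ and every positive integer $n$, $\tfrac23<f_k(n)<2$.
   Context: $p$ always denotes a prime. For positive integers $k,n$: $\psi_k(x)=\dfrac{x^k-(x-1)^k+(-1)^k}{x}$. $C_k=\prod_{p}\left(1-\dfrac{\psi_k(p)}{p^k}\right)$, the product being over all primes $p$. $f_k(n)=\prod_{p\mid n}\left(1+\dfrac{(-1)^k}{p^k-\psi_k(p)}\right)$, the product being over the primes $p$ dividing $n$ (empty product equal to $1$). -}

module Defs where

open import Data.Integer.Base as ℤ using (+_)
import Data.Integer.Properties as ℤ
open import Data.Nat.Base as ℕ using (ℕ; zero; suc)
open import Data.Nat.Divisibility using (_∣?_)
open import Data.Nat.Primality using (prime?; prime⇒nonTrivial)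
open import Data.Product.Base using (∃-syntax; _×_; _,_)
open import Data.Rational.Base
open import Data.Rational.Properties
import Data.Rational.Unnormalised.Base as ℚᵘ
import Data.Rational.Unnormalised.Properties as ℚᵘ
open import Data.Rational.Solver using (module +-*-Solver)
open import Data.Sum.Base using (_⊎_; inj₁; inj₂)
open import Level using (0ℓ)
open import Relation.Binary.PropositionalEquality
open import Relation.Nullary using (Dec; yes; no)
open import Relation.Nullary.Decidable using (_×-dec_; from-yes)
open import Relation.Unary using (Pred; Decidable)

open import Algebra.Definitions.RawSemiring +-*-rawSemiring public using (_^_)

ι : ℕ → ℚ
ι n = + n / 1

-- Only order and limits of reals are used, so no equality is defined.
record ℝ : Set where
  constructor mkℝ
  field
    seq      : ℕ → ℚ
    isCauchy : ∀ ε → 0ℚ < ε →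
               ∃[ N ] (∀ m n → N ℕ.≤ m → N ℕ.≤ n → ∣ seq m - seq n ∣ < ε)

open ℝ public

infix 4 _<ℝ_ _⟶_

_<ℝ_ : ℝ → ℝ → Set
x <ℝ y = ∃[ ε ] (0ℚ < ε × ∃[ N ] (∀ n → N ℕ.≤ n → seq x n + ε ≤ seq y n))

fromℚ : ℚ → ℝ
fromℚ q = mkℝ (λ _ → q) λ ε 0<ε →
  0 , λ _ _ _ _ → subst (_< ε) (cong ∣_∣ (sym (+-inverseʳ q))) 0<ε

-- ∣ a n - L ∣ < ε is written as a n - ε < L < a n + ε, avoiding real subtraction.
_⟶_ : (ℕ → ℚ) → ℝ → Set
a ⟶ L = ∀ ε → 0ℚ < ε → ∃[ N ] (∀ n → N ℕ.≤ n →
  fromℚ (a n - ε) <ℝ L × L <ℝ fromℚ (a n + ε))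

factorIf : {A : Set} → Dec A → (A → ℚ) → ℚ
factorIf (yes a) F = F a
factorIf (no _)  F = 1ℚ

-- ∏< n P? F is the product of F i over the i < n satisfying P.
∏< : ℕ → {P : Pred ℕ 0ℓ} → Decidable P → (∀ i → P i → ℚ) → ℚ
∏< zero    P? F = 1ℚ
∏< (suc n) P? F = ∏< n P? F * factorIf (P? n) (F n)

ψ : ℕ → (x : ℚ) → .{{_ : NonZero x}} → ℚ
ψ k x = (x ^ k - (x - 1ℚ) ^ k + (- 1ℚ) ^ k) ÷ x

1≤⇒>0 : ∀ {x} → 1ℚ ≤ x → 0ℚ < x
1≤⇒>0 = <-≤-trans (from-yes (0ℚ <? 1ℚ))

ι-mono-≤ : ∀ {m n} → m ℕ.≤ n → ι m ≤ ι n
ι-mono-≤ {m} {n} m≤n = toℚᵘ-cancel-≤ (begin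
  toℚᵘ (ι m)          ≃⟨ toℚᵘ-fromℚᵘ (ℚᵘ.mkℚᵘ (+ m) 0) ⟩
  ℚᵘ.mkℚᵘ (+ m) 0     ≤⟨ ℚᵘ.*≤* (ℤ.*-monoʳ-≤-nonNeg (+ 1) (ℤ.+≤+ m≤n)) ⟩
  ℚᵘ.mkℚᵘ (+ n) 0     ≃⟨ toℚᵘ-fromℚᵘ (ℚᵘ.mkℚᵘ (+ n) 0) ⟨
  toℚᵘ (ι n)          ∎)
  where open ℚᵘ.≤-Reasoning

2≤ι : ∀ p → .{{ℕ.NonTrivial p}} → ι 2 ≤ ι p
2≤ι p = ι-mono-≤ (ℕ.nonTrivial⇒n>1 p)

1≤ι : ∀ p → .{{ℕ.NonTrivial p}} → 1ℚ ≤ ι p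
1≤ι p = ≤-trans (from-yes (1ℚ ≤? ι 2)) (2≤ι p)

1≤^ : ∀ {x} → 1ℚ ≤ x → ∀ k → 1ℚ ≤ x ^ k
1≤^ 1≤x zero = ≤-refl
1≤^ {x} 1≤x (suc k) = begin
  1ℚ          ≤⟨ 1≤x ⟩
  x           ≡⟨ *-identityʳ x ⟨
  x * 1ℚ      ≤⟨ *-monoˡ-≤-nonNeg x {{nonNegative (<⇒≤ (1≤⇒>0 1≤x))}} (1≤^ 1≤x k) ⟩
  x * x ^ k   ∎
  where open ≤-Reasoning

-1^k≡±1 : ∀ k → (- 1ℚ) ^ k ≡ 1ℚ ⊎ (- 1ℚ) ^ k ≡ - 1ℚ
-1^k≡±1 zero = inj₁ refl
-1^k≡±1 (suc k) with -1^k≡±1 k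
... | inj₁ eq = inj₂ (cong (- 1ℚ *_) eq)
... | inj₂ eq = inj₁ (cong (- 1ℚ *_) eq)

-1^k≤1 : ∀ k → (- 1ℚ) ^ k ≤ 1ℚ
-1^k≤1 k with -1^k≡±1 k
... | inj₁ eq = ≤-reflexive eq
... | inj₂ eq = ≤-trans (≤-reflexive eq) (from-yes (- 1ℚ ≤? 1ℚ))

module _ (p : ℕ) .{{_ : ℕ.NonTrivial p}} where

  p-nonZero : NonZero (ι p)
  p-nonZero = >-nonZero (1≤⇒>0 (1≤ι p))

  p^k-nonZero : ∀ k → NonZero (ι p ^ k)
  p^k-nonZero k = >-nonZero (1≤⇒>0 (1≤^ (1≤ι p) k))

  private instance _ = p-nonZero

  -- p (p^k - ψ_k(p)) = p^k (p - 1) + (p - 1)^k - (-1)^k ≥ 1 + 1 - 1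
  ψ<p^k : ∀ k → 0ℚ < ι p ^ k - ψ k (ι p)
  ψ<p^k k = *-cancelˡ-<-nonNeg x {{nonNegative (<⇒≤ (1≤⇒>0 (1≤ι p)))}} (begin-strict
    x * 0ℚ                              ≡⟨ *-zeroʳ x ⟩
    0ℚ                                  <⟨ from-yes (0ℚ <? 1ℚ + 1ℚ - 1ℚ) ⟩
    1ℚ + 1ℚ - 1ℚ                        ≤⟨ +-mono-≤ (+-mono-≤ 1≤X*y (1≤^ 1≤y k))
                                                    (neg-antimono-≤ (-1^k≤1 k)) ⟩
    X * y + y ^ k - s                   ≡⟨ expand ⟩
    x * X - (X - y ^ k + s) * 1ℚ        ≡⟨ cong (λ z → x * X - (X - y ^ k + s) * z)
                                                (*-inverseʳ x) ⟨
    x * X - (X - y ^ k + s) * (x * 1/ x)  ≡⟨ collect ⟩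
    x * (X - ψ k x)                     ∎)
    where
    open ≤-Reasoning
    x = ι p
    X = x ^ k
    y = x - 1ℚ
    s = (- 1ℚ) ^ k

    1≤y : 1ℚ ≤ y
    1≤y = +-monoˡ-≤ (- 1ℚ) (2≤ι p)

    1≤X*y : 1ℚ ≤ X * y
    1≤X*y = ≤-trans 1≤y (≤-trans (≤-reflexive (sym (*-identityˡ y)))
      (*-monoʳ-≤-nonNeg y {{nonNegative (<⇒≤ (1≤⇒>0 1≤y))}} (1≤^ (1≤ι p) k)))

    open +-*-Solver

    expand : X * y + y ^ k - s ≡ x * X - (X - y ^ k + s) * 1ℚ
    expand = solve 4 (λ x X Y s →
      X :* (x :- con 1ℚ) :+ Y :- s :=
      x :* X :- (X :- Y :+ s) :* con 1ℚ) refl x X (y ^ k) s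

    collect : x * X - (X - y ^ k + s) * (x * 1/ x) ≡ x * (X - ψ k x)
    collect = solve 5 (λ x X Y s r →
      x :* X :- (X :- Y :+ s) :* (x :* r) :=
      x :* (X :- (X :- Y :+ s) :* r)) refl x X (y ^ k) s (1/ x)

  p^k-ψ-nonZero : ∀ k → NonZero (ι p ^ k - ψ k (ι p))
  p^k-ψ-nonZero k = >-nonZero (ψ<p^k k)

  C-factor : ℕ → ℚ
  C-factor k = 1ℚ - (ψ k (ι p) ÷ (ι p ^ k)) {{p^k-nonZero k}}

  f-factor : ℕ → ℚ
  f-factor k = 1ℚ + ((- 1ℚ) ^ k ÷ (ι p ^ k - ψ k (ι p))) {{p^k-ψ-nonZero k}}

C-partial : ℕ → ℕ → ℚ
C-partial k N = ∏< (suc N) prime? (λ p pr → C-factor p {{prime⇒nonTrivial pr}} k)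

-- A product over all primes is the limit of the products over the primes
-- p ≤ N.  Together with 0 < c this also gives convergence in the strict
-- sense, which excludes the limit 0.
IsC : ℕ → ℝ → Set
IsC k c = C-partial k ⟶ c

-- For n ≥ 1 every prime divisor of n is at most n.
f : ℕ → ∀ n → .{{ℕ.NonZero n}} → ℚ
f k n = ∏< (suc n) (λ p → prime? p ×-dec p ∣? n)
  (λ p (pr , _) → f-factor p {{prime⇒nonTrivial pr}} k)

{-# OPTIONS --safe #-}

-- Since p ψ_k(p) = p^k - (p-1)^k + (-1)^k, Bernoulli's inequality gives
-- 0 < 1 - (factor of C_k at p) ≤ (k+1)/p².  Hence the partial products decrease, and the
-- telescoping sum of 1/(p(p-1)) controls the relative loss beyond N by (k+1)/N: they are
-- Cauchy and stay above a positive constant.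
--
-- For f_k, p^k - ψ_k(p) ≥ p^j (p-1) for all j < k.  With j = 1 for even k and j = 2 for
-- odd k (so k ≥ 3), f_k(n) lies between 1 and ∏ (1 + 1/(p(p-1))), respectively between
-- ∏ (1 - 1/(p²(p-1))) and 1.  Both products are computed over p < 30, and the
-- remaining factors are bounded by telescoping products over all integers.

module Submission where

open import Defs
import Data.Integer.Base as ℤ
import Data.Integer.Properties as ℤ
open import Data.Integer.Base using (+_; +[1+_])
open import Data.Nat.Base as ℕ using (ℕ; zero; suc; s≤s; z≤n)
import Data.Nat.Properties as ℕ
open import Data.Nat.Divisibility using (_∣_; _∣?_)
open import Data.Nat.Primality using (Prime; prime?; prime⇒nonTrivial)
open import Data.Product.Base using (∃-syntax; _×_; _,_; proj₁)
open import Data.Rational.Base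
open import Data.Rational.Properties
import Data.Rational.Unnormalised.Base as ℚᵘ
import Data.Rational.Unnormalised.Properties as ℚᵘ
open import Data.Rational.Solver using (module +-*-Solver)
open import Data.Sum.Base using (inj₁; inj₂; [_,_]′)
open import Level using (0ℓ)
open import Relation.Binary.PropositionalEquality
open import Relation.Nullary using (¬_; Dec; yes; no; contradiction)
open import Relation.Nullary.Decidable using (_×-dec_; from-yes)
open import Relation.Unary using (Pred; Decidable)

open +-*-Solver

-- Order, reciprocals and absolute value in the rationals.

0<1 : 0ℚ < 1ℚ
0<1 = from-yes (0ℚ <? 1ℚ)

0≤1 : 0ℚ ≤ 1ℚ
0≤1 = <⇒≤ 0<1

*-monoˡ-≤ : ∀ {z x y} → 0ℚ ≤ z → x ≤ y → z * x ≤ z * y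
*-monoˡ-≤ {z} 0≤z = *-monoˡ-≤-nonNeg z {{nonNegative 0≤z}}

*-monoʳ-< : ∀ {z x y} → 0ℚ < z → x < y → z * x < z * y
*-monoʳ-< {z} 0<z = *-monoʳ-<-pos z {{positive 0<z}}

*-cancelˡ-≤ : ∀ {z x y} → 0ℚ < z → z * x ≤ z * y → x ≤ y
*-cancelˡ-≤ {z} 0<z = *-cancelˡ-≤-pos z {{positive 0<z}}

*-cancelˡ-< : ∀ {z x y} → 0ℚ < z → z * x < z * y → x < y
*-cancelˡ-< {z} 0<z = *-cancelˡ-<-nonNeg z {{nonNegative (<⇒≤ 0<z)}}

0≤* : ∀ {x y} → 0ℚ ≤ x → 0ℚ ≤ y → 0ℚ ≤ x * y
0≤* {x} 0≤x 0≤y = subst₂ _≤_ (*-zeroʳ x) refl (*-monoˡ-≤ 0≤x 0≤y)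

0<* : ∀ {x y} → 0ℚ < x → 0ℚ < y → 0ℚ < x * y
0<* {x} 0<x 0<y = subst₂ _<_ (*-zeroʳ x) refl (*-monoʳ-< 0<x 0<y)

-- Reduces an inequality to a ring identity with an explicit nonnegative gap `d`; the solver then
-- checks the identity.
≤-by : ∀ {x y d} → 0ℚ ≤ d → x + d ≡ y → x ≤ y
≤-by {x} 0≤d eq =
  subst₂ _≤_ (+-identityʳ x) eq (+-monoʳ-≤ x 0≤d)

<-by : ∀ {x y d} → 0ℚ < d → x + d ≡ y → x < y
<-by {x} 0<d eq =
  subst₂ _<_ (+-identityʳ x) eq (+-monoʳ-< x 0<d)

x≤y⇒0≤y-x : ∀ {x y} → x ≤ y → 0ℚ ≤ y - x
x≤y⇒0≤y-x {x} x≤y = subst₂ _≤_ (+-inverseʳ x) refl (+-monoˡ-≤ (- x) x≤y)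

x<y⇒0<y-x : ∀ {x y} → x < y → 0ℚ < y - x
x<y⇒0<y-x {x} x<y = subst₂ _<_ (+-inverseʳ x) refl (+-monoˡ-< (- x) x<y)

0<1/ : ∀ {x} .{{_ : NonZero x}} → 0ℚ < x → 0ℚ < 1/ x
0<1/ {x} 0<x = *-cancelˡ-< 0<x
  (subst₂ _<_ (sym (*-zeroʳ x)) (sym (*-inverseʳ x)) 0<1)

1/-antimono-≤ : ∀ {x y} .{{_ : NonZero x}} .{{_ : NonZero y}} →
                0ℚ < x → x ≤ y → 1/ y ≤ 1/ x
1/-antimono-≤ {x} {y} 0<x x≤y = *-cancelˡ-≤ (0<* 0<x 0<y) (begin
  x * y * 1/ y    ≡⟨ *-assoc x y _ ⟩
  x * (y * 1/ y)  ≡⟨ cong (x *_) (*-inverseʳ y) ⟩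
  x * 1ℚ          ≡⟨ *-identityʳ x ⟩
  x               ≤⟨ x≤y ⟩
  y               ≡⟨ *-identityʳ y ⟨
  y * 1ℚ          ≡⟨ cong (y *_) (*-inverseʳ x) ⟨
  y * (x * 1/ x)  ≡⟨ *-assoc y x _ ⟨
  y * x * 1/ x    ≡⟨ cong (_* 1/ x) (*-comm y x) ⟩
  x * y * 1/ x    ∎)
  where
  open ≤-Reasoning
  0<y = <-≤-trans 0<x x≤y

p≤∣p∣ : ∀ p → p ≤ ∣ p ∣
p≤∣p∣ p with ∣p∣≡p∨∣p∣≡-p p
... | inj₁ eq = ≤-reflexive (sym eq)
... | inj₂ eq = ≤-by (+-mono-≤ (0≤∣p∣ p) (0≤∣p∣ p)) (begin
  p + (∣ p ∣ + ∣ p ∣)  ≡⟨ cong (λ z → p + (∣ p ∣ + z)) eq ⟩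
  p + (∣ p ∣ - p)      ≡⟨ solve 2 (λ p q → p :+ (q :- p) := q) refl p ∣ p ∣ ⟩
  ∣ p ∣                ∎)
  where open ≡-Reasoning

∣-∣≤ : ∀ {l h x y} → l ≤ x → x ≤ h → l ≤ y → y ≤ h → ∣ x - y ∣ ≤ h - l
∣-∣≤ {l} {h} {x} {y} l≤x x≤h l≤y y≤h with ∣p∣≡p∨∣p∣≡-p (x - y)
... | inj₁ eq = ≤-trans (≤-reflexive eq) (+-mono-≤ x≤h (neg-antimono-≤ l≤y))
... | inj₂ eq = ≤-trans
  (≤-reflexive (trans eq (solve 2 (λ x y → :- (x :- y) := y :- x) refl x y)))
  (+-mono-≤ y≤h (neg-antimono-≤ l≤x))

-- Embedded naturals and the Archimedean property.

toℚᵘ-ι : ∀ n → toℚᵘ (ι n) ℚᵘ.≃ ℚᵘ.mkℚᵘ (+ n) 0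
toℚᵘ-ι n = toℚᵘ-fromℚᵘ (ℚᵘ.mkℚᵘ (+ n) 0)

ι-suc : ∀ n → ι (suc n) ≡ ι n + 1ℚ
ι-suc n = toℚᵘ-injective (begin
  toℚᵘ (ι (suc n))                  ≈⟨ toℚᵘ-ι (suc n) ⟩
  ℚᵘ.mkℚᵘ (+ suc n) 0               ≈⟨ ℚᵘ.*≡* (cong (ℤ._* + 1) eq) ⟩
  ℚᵘ.mkℚᵘ (+ n) 0 ℚᵘ.+ toℚᵘ 1ℚ      ≈⟨ ℚᵘ.+-congˡ (toℚᵘ 1ℚ) (toℚᵘ-ι n) ⟨
  toℚᵘ (ι n) ℚᵘ.+ toℚᵘ 1ℚ           ≈⟨ toℚᵘ-homo-+ (ι n) 1ℚ ⟨
  toℚᵘ (ι n + 1ℚ)                   ∎)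
  where
  open ℚᵘ.≃-Reasoning
  eq : + suc n ≡ + n ℤ.* + 1 ℤ.+ + 1
  eq = trans (cong +_ (ℕ.+-comm 1 n)) (cong (ℤ._+ + 1) (sym (ℤ.*-identityʳ (+ n))))

0≤ι : ∀ n → 0ℚ ≤ ι n
0≤ι n = ι-mono-≤ {0} {n} z≤n

0<ι : ∀ n → 0ℚ < ι (suc n)
0<ι n = <-≤-trans 0<1 (ι-mono-≤ {1} {suc n} (s≤s z≤n))

ι-nonZero : ∀ n → NonZero (ι (suc n))
ι-nonZero n = >-nonZero (0<ι n)

-- The shift to 1/(n+1) keeps every denominator nonzero; differences of consecutive values are the
-- telescoping terms 1/((n+1)(n+2)).
u : ℕ → ℚ
u n = (1/ ι (suc n)) {{ι-nonZero n}}

ι*u : ∀ n → ι (suc n) * u n ≡ 1ℚ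
ι*u n = *-inverseʳ (ι (suc n)) {{ι-nonZero n}}

0<u : ∀ n → 0ℚ < u n
0<u n = 0<1/ {{ι-nonZero n}} (0<ι n)

-- A positive ε = (a+1)/(d+1) is at least 1/(d+1), which exceeds 1/(d+2) = `u (suc d)`.
u-archimedean : ∀ {ε} → 0ℚ < ε → ∃[ n ] u n < ε
u-archimedean {ε@(mkℚ +[1+ a ] d _)} _ = suc d , *-cancelˡ-< (0<ι (suc d)) (begin-strict
  ι m * u (suc d)   ≡⟨ ι*u (suc d) ⟩
  1ℚ                <⟨ toℚᵘ-cancel-< 1<m*ε ⟩
  ι m * ε           ∎)
  where
  open ≤-Reasoning
  m = suc (suc d)
  1<m*ε : toℚᵘ 1ℚ ℚᵘ.< toℚᵘ (ι m * ε)
  1<m*ε = ℚᵘ.<-respʳ-≃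
    (ℚᵘ.≃-sym (ℚᵘ.≃-trans (toℚᵘ-homo-* (ι m) ε) (ℚᵘ.*-congʳ {toℚᵘ ε} (toℚᵘ-ι m))))
    (ℚᵘ.*<* (subst₂ ℤ._<_ eqˡ eqʳ (ℤ.+<+ (ℕ.m≤m*n m (suc a)))))
    where
    eqˡ : + suc d ≡ + 1 ℤ.* + suc (d ℕ.+ 0)
    eqˡ = sym (trans (ℤ.*-identityˡ _) (cong (λ z → + suc z) (ℕ.+-identityʳ d)))
    eqʳ : + (m ℕ.* suc a) ≡ (+ m ℤ.* +[1+ a ]) ℤ.* + 1
    eqʳ = sym (ℤ.*-identityʳ _)
u-archimedean {mkℚ (+ 0) _ _} (*<* (ℤ.+<+ ()))
u-archimedean {mkℚ (ℤ.-[1+ _ ]) _ _} (*<* ())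

u-archimedean-* : ∀ {K ε} → 0ℚ < K → 0ℚ < ε → ∃[ n ] K * u n < ε
u-archimedean-* {K} {ε} 0<K 0<ε with u-archimedean (0<* 0<ε (0<1/ {{K≢0}} 0<K))
  where K≢0 = >-nonZero 0<K
... | n , u<ε/K = n , (begin-strict
  K * u n           <⟨ *-monoʳ-< 0<K u<ε/K ⟩
  K * (ε * 1/ K)    ≡⟨ solve 3 (λ K ε r → K :* (ε :* r) := ε :* (K :* r)) refl K ε (1/ K) ⟩
  ε * (K * 1/ K)    ≡⟨ cong (ε *_) (*-inverseʳ K) ⟩
  ε * 1ℚ            ≡⟨ *-identityʳ ε ⟩
  ε                 ∎)
  where
  open ≤-Reasoning
  instance _ = >-nonZero 0<K

-- Convergence of a Cauchy sequence to the real it represents.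

-- Half of ε pays for Cauchy closeness; the other half is the uniform gap that `_<ℝ_` demands.
seq⟶ : ∀ x → seq x ⟶ x
seq⟶ x ε 0<ε with isCauchy x (ε * ½) (0<* 0<ε (from-yes (0ℚ <? ½)))
... | N , close = N , λ n N≤n →
  (ε * ½ , 0<ε/2 , N , λ m N≤m → below n m (close n m N≤n N≤m)) ,
  (ε * ½ , 0<ε/2 , N , λ m N≤m → above n m (close m n N≤m N≤n))
  where
  0<ε/2 = 0<* 0<ε (from-yes (0ℚ <? ½))
  a-b<h : ∀ a b → ∣ a - b ∣ < ε * ½ → 0ℚ ≤ ε * ½ - (a - b)
  a-b<h a b lt = x≤y⇒0≤y-x (≤-trans (p≤∣p∣ (a - b)) (<⇒≤ lt))
  below : ∀ n m → ∣ seq x n - seq x m ∣ < ε * ½ → seq x n - ε + ε * ½ ≤ seq x m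
  below n m lt = ≤-by (a-b<h (seq x n) (seq x m) lt) (solve 3 (λ a b e →
    a :- e :+ e :* con ½ :+ (e :* con ½ :- (a :- b)) := b) refl (seq x n) (seq x m) ε)
  above : ∀ n m → ∣ seq x m - seq x n ∣ < ε * ½ → seq x m + ε * ½ ≤ seq x n + ε
  above n m lt = ≤-by (a-b<h (seq x m) (seq x n) lt) (solve 3 (λ a b e →
    b :+ e :* con ½ :+ (e :* con ½ :- (b :- a)) := a :+ e) refl (seq x n) (seq x m) ε)

-- Bounds and comparison for products over decidable index sets.

factorIf-elim : ∀ {A : Set} (R : ℚ → Set) (d : Dec A) {F : A → ℚ} →
                (∀ a → R (F a)) → R 1ℚ → R (factorIf d F)
factorIf-elim R (yes a) RF R1 = RF a
factorIf-elim R (no _)  RF R1 = R1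

-- Serves to compare products over different index sets: where only one condition holds, the other
-- side contributes the default factor 1.
factorIf-mono : ∀ {A B : Set} (d : Dec A) (e : Dec B) {F : A → ℚ} {G : B → ℚ} →
                (∀ a b → F a ≤ G b) → (∀ a → ¬ B → F a ≤ 1ℚ) → (∀ b → ¬ A → 1ℚ ≤ G b) →
                factorIf d F ≤ factorIf e G
factorIf-mono (yes a) (yes b) F≤G F≤1 1≤G = F≤G a b
factorIf-mono (yes a) (no ¬b) F≤G F≤1 1≤G = F≤1 a ¬b
factorIf-mono (no ¬a) (yes b) F≤G F≤1 1≤G = 1≤G b ¬a
factorIf-mono (no _)  (no _)  F≤G F≤1 1≤G = ≤-refl

module _ {P : Pred ℕ 0ℓ} (P? : Decidable P) {F : ∀ i → P i → ℚ} where

  0<∏< : (∀ i (pi : P i) → 0ℚ < F i pi) → ∀ n → 0ℚ < ∏< n P? F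
  0<∏< 0<F zero    = 0<1
  0<∏< 0<F (suc n) = 0<* (0<∏< 0<F n) (factorIf-elim (0ℚ <_) (P? n) (0<F n) 0<1)

  1≤∏< : (∀ i (pi : P i) → 1ℚ ≤ F i pi) → ∀ n → 1ℚ ≤ ∏< n P? F
  1≤∏< 1≤F zero    = ≤-refl
  1≤∏< 1≤F (suc n) = ≤-trans (1≤∏< 1≤F n) (subst₂ _≤_ (*-identityʳ _) refl
    (*-monoˡ-≤ (≤-trans 0≤1 (1≤∏< 1≤F n)) (factorIf-elim (1ℚ ≤_) (P? n) (1≤F n) ≤-refl)))

  module _ (0<F : ∀ i (pi : P i) → 0ℚ < F i pi) where

    ∏<-suc-≤ : (∀ i (pi : P i) → F i pi ≤ 1ℚ) → ∀ n → ∏< (suc n) P? F ≤ ∏< n P? F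
    ∏<-suc-≤ F≤1 n = subst₂ _≤_ refl (*-identityʳ _)
      (*-monoˡ-≤ (<⇒≤ (0<∏< 0<F n)) (factorIf-elim (_≤ 1ℚ) (P? n) (F≤1 n) ≤-refl))

    ∏<-suc-≥ : (∀ i (pi : P i) → 1ℚ ≤ F i pi) → ∀ n → ∏< n P? F ≤ ∏< (suc n) P? F
    ∏<-suc-≥ 1≤F n = subst₂ _≤_ (*-identityʳ _) refl
      (*-monoˡ-≤ (<⇒≤ (0<∏< 0<F n)) (factorIf-elim (1ℚ ≤_) (P? n) (1≤F n) ≤-refl))

    ∏<≤1 : (∀ i (pi : P i) → F i pi ≤ 1ℚ) → ∀ n → ∏< n P? F ≤ 1ℚ
    ∏<≤1 F≤1 zero    = ≤-refl
    ∏<≤1 F≤1 (suc n) = ≤-trans (∏<-suc-≤ F≤1 n) (∏<≤1 F≤1 n)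

∏<-mono : ∀ {P Q : Pred ℕ 0ℓ} (P? : Decidable P) (Q? : Decidable Q)
          {F : ∀ i → P i → ℚ} {G : ∀ i → Q i → ℚ} →
          (∀ i (pi : P i) → 0ℚ < F i pi) →
          (∀ i → factorIf (P? i) (F i) ≤ factorIf (Q? i) (G i)) →
          ∀ n → ∏< n P? F ≤ ∏< n Q? G
∏<-mono P? Q? 0<F F≤G zero = ≤-refl
∏<-mono P? Q? {F} {G} 0<F F≤G (suc n) = begin
  ∏< n P? F * factorIf (P? n) (F n)   ≤⟨ *-monoˡ-≤ (<⇒≤ (0<∏< P? 0<F n)) (F≤G n) ⟩
  ∏< n P? F * factorIf (Q? n) (G n)   ≤⟨ *-monoʳ-≤-nonNeg _ {{nonNegative 0≤G}} (∏<-mono P? Q? 0<F F≤G n) ⟩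
  ∏< n Q? G * factorIf (Q? n) (G n)   ∎
  where
  open ≤-Reasoning
  -- The right-hand factor dominates a positive one.
  0≤G = ≤-trans (<⇒≤ (factorIf-elim (0ℚ <_) (P? n) (0<F n) 0<1)) (F≤G n)

-- Powers and Bernoulli's inequality.

0≤^ : ∀ {x} → 0ℚ ≤ x → ∀ k → 0ℚ ≤ x ^ k
0≤^ 0≤x zero    = 0≤1
0≤^ 0≤x (suc k) = 0≤* 0≤x (0≤^ 0≤x k)

^-monoˡ-≤ : ∀ {x y} → 0ℚ ≤ x → x ≤ y → ∀ k → x ^ k ≤ y ^ k
^-monoˡ-≤ 0≤x x≤y zero = ≤-refl
^-monoˡ-≤ {x} {y} 0≤x x≤y (suc k) = ≤-trans
  (*-monoˡ-≤ 0≤x (^-monoˡ-≤ 0≤x x≤y k))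
  (*-monoʳ-≤-nonNeg (y ^ k) {{nonNegative (0≤^ (≤-trans 0≤x x≤y) k)}} x≤y)

^-monoʳ-≤ : ∀ {x} → 1ℚ ≤ x → ∀ {j k} → j ℕ.≤ k → x ^ j ≤ x ^ k
^-monoʳ-≤ 1≤x {k = k} z≤n = 1≤^ 1≤x k
^-monoʳ-≤ 1≤x (s≤s j≤k) = *-monoˡ-≤ (<⇒≤ (1≤⇒>0 1≤x)) (^-monoʳ-≤ 1≤x j≤k)

-1≤-1^k : ∀ k → - 1ℚ ≤ (- 1ℚ) ^ k
-1≤-1^k k with -1^k≡±1 k
... | inj₁ eq = ≤-trans (from-yes (- 1ℚ ≤? 1ℚ)) (≤-reflexive (sym eq))
... | inj₂ eq = ≤-reflexive (sym eq)

x-1≤x : ∀ x → x - 1ℚ ≤ x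
x-1≤x x = ≤-by 0≤1 (solve 1 (λ x → x :- con 1ℚ :+ con 1ℚ := x) refl x)

-- This is (1 - 1/x)^k ≥ 1 - k/x multiplied by x^(k+1), which avoids quotients and the exponent k -
-- 1. In the induction the new gap is x times the sum of the old gap and x^k - (x-1)^k.
bernoulli : ∀ {x} → 1ℚ ≤ x → ∀ k → x * (x ^ k - (x - 1ℚ) ^ k) ≤ ι k * x ^ k
bernoulli {x} 1≤x zero = ≤-reflexive (*-zeroʳ x)
bernoulli {x} 1≤x (suc k) = ≤-by
  (0≤* (<⇒≤ (1≤⇒>0 1≤x)) (+-mono-≤ (x≤y⇒0≤y-x (bernoulli 1≤x k))
    (x≤y⇒0≤y-x (^-monoˡ-≤ (x≤y⇒0≤y-x 1≤x) (x-1≤x x) k))))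
  (trans
    (solve 4 (λ x X Y i →
      x :* (x :* X :- (x :- con 1ℚ) :* Y) :+
        x :* ((i :* X :- x :* (X :- Y)) :+ (X :- Y)) :=
      (i :+ con 1ℚ) :* (x :* X)) refl x (x ^ k) ((x - 1ℚ) ^ k) (ι k))
    (cong (_* (x * x ^ k)) (sym (ι-suc k))))

-- The two sides differ by (x-1)(x^k - (x-1)^k). This bounds the numerator of `ψ` from below.
x^k≤x^1+k-[x-1]^1+k : ∀ {x} → 1ℚ ≤ x → ∀ k → x ^ k ≤ x ^ suc k - (x - 1ℚ) ^ suc k
x^k≤x^1+k-[x-1]^1+k {x} 1≤x k = ≤-by
  (0≤* (x≤y⇒0≤y-x 1≤x) (x≤y⇒0≤y-x (^-monoˡ-≤ (x≤y⇒0≤y-x 1≤x) (x-1≤x x) k)))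
  (solve 3 (λ x X Y → X :+ (x :- con 1ℚ) :* (X :- Y) :=
    x :* X :- (x :- con 1ℚ) :* Y) refl x (x ^ k) ((x - 1ℚ) ^ k))

-- Estimates for the factors at a single p.

module _ (p : ℕ) .{{_ : ℕ.NonTrivial p}} where

  private
    instance _ = p-nonZero p
    x = ι p
    y = x - 1ℚ

    0<x : 0ℚ < x
    0<x = 1≤⇒>0 (1≤ι p)

    1≤y : 1ℚ ≤ y
    1≤y = +-monoˡ-≤ (- 1ℚ) (2≤ι p)

    0<x^ : ∀ k → 0ℚ < x ^ k
    0<x^ k = 1≤⇒>0 (1≤^ (1≤ι p) k)

  -- Multiplying by p clears the division in `ψ`; the estimates for both kinds of factor start from
  -- this form.
  p*[p^k-ψ] : ∀ k → x * (x ^ k - ψ k x) ≡ x ^ k * y + y ^ k - (- 1ℚ) ^ k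
  p*[p^k-ψ] k = begin
    x * (X - (X - Y + s) * 1/ x)      ≡⟨ solve 5 (λ x X Y s r →
      x :* (X :- (X :- Y :+ s) :* r) := x :* X :- (X :- Y :+ s) :* (x :* r)) refl x X Y s (1/ x) ⟩
    x * X - (X - Y + s) * (x * 1/ x)  ≡⟨ cong (λ z → x * X - (X - Y + s) * z) (*-inverseʳ x) ⟩
    x * X - (X - Y + s) * 1ℚ          ≡⟨ solve 4 (λ x X Y s →
      x :* X :- (X :- Y :+ s) :* con 1ℚ := X :* (x :- con 1ℚ) :+ Y :- s) refl x X Y s ⟩
    X * y + Y - s                     ∎
    where
    open ≡-Reasoning
    X = x ^ k
    Y = y ^ k
    s = (- 1ℚ) ^ k

  p^k*C-factor : ∀ k → x ^ k * C-factor p k ≡ x ^ k - ψ k x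
  p^k*C-factor k = begin
    X * (1ℚ - ψ k x * r)     ≡⟨ solve 3 (λ X w r →
      X :* (con 1ℚ :- w :* r) := X :- w :* (X :* r)) refl X (ψ k x) r ⟩
    X - ψ k x * (X * r)      ≡⟨ cong (λ z → X - ψ k x * z) (*-inverseʳ X {{p^k-nonZero p k}}) ⟩
    X - ψ k x * 1ℚ           ≡⟨ cong (λ z → X - z) (*-identityʳ (ψ k x)) ⟩
    X - ψ k x                ∎
    where
    open ≡-Reasoning
    X = x ^ k
    r = (1/ X) {{p^k-nonZero p k}}

  0<C-factor : ∀ k → 0ℚ < C-factor p k
  0<C-factor k = *-cancelˡ-< (0<x^ k) (subst₂ _<_ (sym (*-zeroʳ (x ^ k))) (sym (p^k*C-factor k)) (ψ<p^k p k))

  -- p^(k+1) (1 - C) = p ψ, the numerator of ψ.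
  p^1+k*[1-C-factor] : ∀ k → x * x ^ k * (1ℚ - C-factor p k) ≡ x ^ k - y ^ k + (- 1ℚ) ^ k
  p^1+k*[1-C-factor] k = begin
    x * X * (1ℚ - C)              ≡⟨ solve 3 (λ x X C → x :* X :* (con 1ℚ :- C) :=
                                       x :* X :- x :* (X :* C)) refl x X C ⟩
    x * X - x * (X * C)           ≡⟨ cong (λ z → x * X - x * z) (p^k*C-factor k) ⟩
    x * X - x * (X - ψ k x)       ≡⟨ cong (λ z → x * X - z) (p*[p^k-ψ] k) ⟩
    x * X - (X * y + Y - s)       ≡⟨ solve 4 (λ x X Y s →
      x :* X :- (X :* (x :- con 1ℚ) :+ Y :- s) := X :- Y :+ s) refl x X Y s ⟩
    X - Y + s                     ∎
    where
    open ≡-Reasoning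
    X = x ^ k
    Y = y ^ k
    s = (- 1ℚ) ^ k
    C = C-factor p k

  -- Scaled by p^(k+1), the deficit becomes the numerator of `ψ`, which is at least p^(k-1) - 1 ≥ 2
  -- - 1. The bound p^(k-1) ≥ p is where k ≥ 2 enters.
  C-factor<1 : ∀ {k} → 2 ℕ.≤ k → C-factor p k < 1ℚ
  C-factor<1 {suc k} (s≤s 1≤k) = <-by 0<1-C (solve 1 (λ c → c :+ (con 1ℚ :- c) := con 1ℚ) refl C)
    where
    open ≤-Reasoning
    C = C-factor p (suc k)
    0<1-C : 0ℚ < 1ℚ - C
    0<1-C = *-cancelˡ-< (0<* 0<x (0<x^ (suc k))) (begin-strict
      x * x ^ suc k * 0ℚ                            ≡⟨ *-zeroʳ (x * x ^ suc k) ⟩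
      0ℚ                                            <⟨ from-yes (0ℚ <? ι 2 - 1ℚ) ⟩
      ι 2 - 1ℚ                                      ≤⟨ +-mono-≤ (≤-trans (2≤ι p)
        (≤-trans (≤-reflexive (sym (*-identityʳ x))) (^-monoʳ-≤ (1≤ι p) 1≤k))) (-1≤-1^k (suc k)) ⟩
      x ^ k + (- 1ℚ) ^ suc k                        ≤⟨ +-monoˡ-≤ ((- 1ℚ) ^ suc k) (x^k≤x^1+k-[x-1]^1+k (1≤ι p) k) ⟩
      x ^ suc k - y ^ suc k + (- 1ℚ) ^ suc k        ≡⟨ p^1+k*[1-C-factor] (suc k) ⟨
      x * x ^ suc k * (1ℚ - C)                      ∎)

  -- After scaling by p^k, Bernoulli yields k p^k, and the sign term contributes at most p ≤ p^k,
  -- hence k + 1.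
  p²*[1-C-factor]≤1+k : ∀ {k} → 2 ℕ.≤ k → x * x * (1ℚ - C-factor p k) ≤ ι (suc k)
  p²*[1-C-factor]≤1+k {k} 2≤k = *-cancelˡ-≤ (0<x^ k) (begin
    X * (x * x * (1ℚ - C))       ≡⟨ solve 3 (λ x X d → X :* (x :* x :* d) := x :* (x :* X :* d)) refl x X (1ℚ - C) ⟩
    x * (x * X * (1ℚ - C))       ≡⟨ cong (x *_) (p^1+k*[1-C-factor] k) ⟩
    x * (X - y ^ k + s)          ≤⟨ *-monoˡ-≤ (<⇒≤ 0<x) (+-monoʳ-≤ (X - y ^ k) (-1^k≤1 k)) ⟩
    x * (X - y ^ k + 1ℚ)         ≡⟨ *-distribˡ-+ x (X - y ^ k) 1ℚ ⟩
    x * (X - y ^ k) + x ^ 1      ≤⟨ +-mono-≤ (bernoulli (1≤ι p) k) (^-monoʳ-≤ (1≤ι p) (ℕ.<⇒≤ 2≤k)) ⟩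
    ι k * X + X                  ≡⟨ solve 2 (λ i X → i :* X :+ X := X :* (i :+ con 1ℚ)) refl (ι k) X ⟩
    X * (ι k + 1ℚ)               ≡⟨ cong (X *_) (ι-suc k) ⟨
    X * ι (suc k)                ∎)
    where
    open ≤-Reasoning
    X = x ^ k
    s = (- 1ℚ) ^ k
    C = C-factor p k

  -- A substitute, independent of k, for the denominator p^k - ψ_k(p) of `f-factor`.
  V : ℕ → ℚ
  V j = x ^ j * y

  0<V : ∀ j → 0ℚ < V j
  0<V j = 0<* (0<x^ j) (1≤⇒>0 1≤y)

  V-nonZero : ∀ j → NonZero (V j)
  V-nonZero j = >-nonZero (0<V j)

  1/V : ℕ → ℚ
  1/V j = (1/ V j) {{V-nonZero j}}

  0<1/V : ∀ j → 0ℚ < 1/V j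
  0<1/V j = 0<1/ {{V-nonZero j}} (0<V j)

  V*1/V : ∀ j → V j * 1/V j ≡ 1ℚ
  V*1/V j = *-inverseʳ (V j) {{V-nonZero j}}

  -- Multiplied by p, the right side is p^k (p-1) plus (p-1)^k - (-1)^k, and the latter is
  -- nonnegative because p - 1 ≥ 1.
  V≤p^k-ψ : ∀ {j k} → j ℕ.< k → V j ≤ x ^ k - ψ k x
  V≤p^k-ψ {j} {k} j<k = *-cancelˡ-≤ 0<x (begin
    x * (x ^ j * y)                    ≡⟨ *-assoc x (x ^ j) y ⟨
    x ^ suc j * y                      ≤⟨ *-monoʳ-≤-nonNeg y {{nonNegative (<⇒≤ (1≤⇒>0 1≤y))}} (^-monoʳ-≤ (1≤ι p) j<k) ⟩
    x ^ k * y                          ≤⟨ ≤-by (x≤y⇒0≤y-x (≤-trans (-1^k≤1 k) (1≤^ 1≤y k)))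
      (solve 3 (λ a b c → a :+ (b :- c) := a :+ b :- c) refl (x ^ k * y) (y ^ k) ((- 1ℚ) ^ k)) ⟩
    x ^ k * y + y ^ k - (- 1ℚ) ^ k     ≡⟨ p*[p^k-ψ] k ⟨
    x * (x ^ k - ψ k x)                ∎)
    where open ≤-Reasoning

  1/W : ℕ → ℚ
  1/W k = (1/ (x ^ k - ψ k x)) {{p^k-ψ-nonZero p k}}

  0<1/W : ∀ k → 0ℚ < 1/W k
  0<1/W k = 0<1/ {{p^k-ψ-nonZero p k}} (ψ<p^k p k)

  1/W≤1/V : ∀ {j k} → j ℕ.< k → 1/W k ≤ 1/V j
  1/W≤1/V {j} {k} j<k = 1/-antimono-≤ {{V-nonZero j}} {{p^k-ψ-nonZero p k}} (0<V j) (V≤p^k-ψ j<k)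

  f-factor-even : ∀ {k} → (- 1ℚ) ^ k ≡ 1ℚ → f-factor p k ≡ 1ℚ + 1/W k
  f-factor-even {k} even = cong (λ z → 1ℚ + z) (trans (cong (_* 1/W k) even) (*-identityˡ (1/W k)))

  f-factor-odd : ∀ {k} → (- 1ℚ) ^ k ≡ - 1ℚ → f-factor p k ≡ 1ℚ - 1/W k
  f-factor-odd {k} odd = cong (λ z → 1ℚ + z) (trans (cong (_* 1/W k) odd)
    (solve 1 (λ w → con (- 1ℚ) :* w := :- w) refl (1/W k)))

  -- The index 1 here is the largest j below k = 2, the least even case; the index 2 in
  -- `lower-factor` is the largest below k = 3, the least odd case.
  upper-factor : ℚ
  upper-factor = 1ℚ + 1/V 1

  lower-factor : ℚ
  lower-factor = 1ℚ - 1/V 2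

-- Convergence of C_k and bounds for its limit.

module _ {k : ℕ} (2≤k : 2 ℕ.≤ k) where

  private
    C : ∀ p → Prime p → ℚ
    C p pr = C-factor p {{prime⇒nonTrivial pr}} k

    c : ℕ → ℚ
    c n = factorIf (prime? n) (C n)

    K : ℚ
    K = ι (suc k)

    0<C : ∀ p (pr : Prime p) → 0ℚ < C p pr
    0<C p pr = 0<C-factor p {{prime⇒nonTrivial pr}} k

    C<1 : ∀ p (pr : Prime p) → C p pr < 1ℚ
    C<1 p pr = C-factor<1 p {{prime⇒nonTrivial pr}} 2≤k

    C≤1 : ∀ p (pr : Prime p) → C p pr ≤ 1ℚ
    C≤1 p pr = <⇒≤ (C<1 p pr)

    -- Runs over the primes up to n + 1, so that its index matches `u n` = 1/(n+1).
    q : ℕ → ℚ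
    q n = C-partial k (suc n)

    0<q : ∀ n → 0ℚ < q n
    0<q n = 0<∏< prime? 0<C (suc (suc n))

    q≤1 : ∀ n → q n ≤ 1ℚ
    q≤1 n = ∏<≤1 prime? 0<C C≤1 (suc (suc n))

    q-antitone : ∀ n j → q (j ℕ.+ n) ≤ q n
    q-antitone n zero    = ≤-refl
    q-antitone n (suc j) = ≤-trans (∏<-suc-≤ prime? 0<C C≤1 (suc (suc (j ℕ.+ n)))) (q-antitone n j)

    -- With x = n + 1, the deficit at p = x + 1 is at most K / p² ≤ K / (x p) = K (1/x - 1/p).
    1-c≤K*[u-u] : ∀ n → 1ℚ - c (suc (suc n)) ≤ K * (u n - u (suc n))
    1-c≤K*[u-u] n = *-cancelˡ-≤ (0<* 0<x 0<p) (begin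
      x * p * (1ℚ - d)                  ≤⟨ x*p*[1-d]≤K ⟩
      K                                 ≡⟨ *-identityʳ K ⟨
      K * 1ℚ                            ≡⟨ cong (K *_) 1≡p-x ⟩
      K * (p * 1ℚ - x * 1ℚ)             ≡⟨ cong₂ (λ a b → K * (p * a - x * b)) (ι*u n) (ι*u (suc n)) ⟨
      K * (p * (x * u n) - x * (p * u (suc n)))
        ≡⟨ solve 5 (λ K x p a b → K :* (p :* (x :* a) :- x :* (p :* b)) :=
             x :* p :* (K :* (a :- b))) refl K x p (u n) (u (suc n)) ⟩
      x * p * (K * (u n - u (suc n)))   ∎)
      where
      open ≤-Reasoning
      x = ι (suc n)
      p = ι (suc (suc n))
      d = c (suc (suc n))
      0<x = 0<ι n
      0<p = 0<ι (suc n)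
      1≡p-x : 1ℚ ≡ p * 1ℚ - x * 1ℚ
      1≡p-x = trans (solve 1 (λ x → con 1ℚ := (x :+ con 1ℚ) :* con 1ℚ :- x :* con 1ℚ) refl x)
                    (cong (λ z → z * 1ℚ - x * 1ℚ) (sym (ι-suc (suc n))))
      x*p*[1-d]≤K : x * p * (1ℚ - d) ≤ K
      x*p*[1-d]≤K = factorIf-elim (λ d → x * p * (1ℚ - d) ≤ K) (prime? (suc (suc n)))
        (λ pr → ≤-trans
          (*-monoʳ-≤-nonNeg (1ℚ - C _ pr) {{nonNegative (x≤y⇒0≤y-x (C≤1 _ pr))}}
            (*-monoʳ-≤-nonNeg p {{nonNegative (<⇒≤ 0<p)}} (ι-mono-≤ (ℕ.n≤1+n (suc n)))))
          (p²*[1-C-factor]≤1+k (suc (suc n)) {{prime⇒nonTrivial pr}} 2≤k))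
        (≤-trans (≤-reflexive (*-zeroʳ (x * p))) (0≤ι (suc k)))

    -- Each further factor `d` loses `q m * (1ℚ - d)`, at most `q n * (1ℚ - d)` since `q` decreases;
    -- the bounds on the deficits then telescope.
    q-tail : ∀ n j → q n - q (j ℕ.+ n) ≤ q n * (K * (u n - u (j ℕ.+ n)))
    q-tail n zero = ≤-reflexive (solve 3 (λ q K u → q :- q := q :* (K :* (u :- u))) refl (q n) K (u n))
    q-tail n (suc j) = begin
      q n - q m * d                                      ≡⟨ solve 3 (λ a b d →
        a :- b :* d := (a :- b) :+ b :* (con 1ℚ :- d)) refl (q n) (q m) d ⟩
      (q n - q m) + q m * (1ℚ - d)                       ≤⟨ +-mono-≤ (q-tail n j) (≤-trans
        (*-monoʳ-≤-nonNeg (1ℚ - d) {{nonNegative 0≤1-d}} (q-antitone n j))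
        (*-monoˡ-≤ (<⇒≤ (0<q n)) (1-c≤K*[u-u] m))) ⟩
      q n * (K * (u n - u m)) + q n * (K * (u m - u (suc m)))  ≡⟨ solve 5 (λ q K a b c →
        q :* (K :* (a :- b)) :+ q :* (K :* (b :- c)) := q :* (K :* (a :- c)))
        refl (q n) K (u n) (u m) (u (suc m)) ⟩
      q n * (K * (u n - u (suc m)))                      ∎
      where
      open ≤-Reasoning
      m = j ℕ.+ n
      d = c (suc (suc m))
      0≤1-d : 0ℚ ≤ 1ℚ - d
      0≤1-d = x≤y⇒0≤y-x (factorIf-elim (_≤ 1ℚ) (prime? (suc (suc m))) (C≤1 (suc (suc m))) ≤-refl)

    C-partial≤q : ∀ {n m} → suc n ℕ.≤ m → C-partial k m ≤ q n
    C-partial≤q {n} {suc m} (s≤s n≤m) =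
      subst (λ m → q m ≤ q n) (ℕ.m∸n+n≡m n≤m) (q-antitone n (m ℕ.∸ n))

    -- Dropping the nonnegative end term of the telescoped bound makes it uniform in m. With
    -- `C-partial≤q` it encloses all later partial products.
    q*[1-K*u]≤C-partial : ∀ {n m} → suc n ℕ.≤ m → q n * (1ℚ - K * u n) ≤ C-partial k m
    q*[1-K*u]≤C-partial {n} {suc m} (s≤s n≤m) =
      subst (λ m → q n * (1ℚ - K * u n) ≤ q m) (ℕ.m∸n+n≡m n≤m) (≤-by
        (+-mono-≤ (x≤y⇒0≤y-x (q-tail n j)) (0≤* (<⇒≤ (0<q n)) (0≤* (0≤ι (suc k)) (<⇒≤ (0<u (j ℕ.+ n))))))
        (solve 5 (λ q K u r v → q :* (con 1ℚ :- K :* u) :+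
          (q :* (K :* (u :- v)) :- (q :- r) :+ q :* (K :* v)) := r)
          refl (q n) K (u n) (q (j ℕ.+ n)) (u (j ℕ.+ n))))
      where j = m ℕ.∸ n

  C-limit : ℝ
  C-limit = mkℝ (C-partial k) cauchy
    where
    cauchy : ∀ ε → 0ℚ < ε → ∃[ N ] (∀ m n → N ℕ.≤ m → N ℕ.≤ n → ∣ C-partial k m - C-partial k n ∣ < ε)
    -- Beyond `N` both values lie in an interval of length `q N * (K * u N)`, at most `K * u N`
    -- because `q N` ≤ 1.
    cauchy ε 0<ε = let N , K*u<ε = u-archimedean-* {K} (0<ι k) 0<ε in suc N , λ m n N<m N<n → ≤-<-trans (≤-trans
      (∣-∣≤ {q N * (1ℚ - K * u N)} {q N} {C-partial k m} {C-partial k n}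
        (q*[1-K*u]≤C-partial {N} {m} N<m) (C-partial≤q {N} {m} N<m)
        (q*[1-K*u]≤C-partial {N} {n} N<n) (C-partial≤q {N} {n} N<n))
      (≤-by (0≤* (0≤* (0≤ι (suc k)) (<⇒≤ (0<u N))) (x≤y⇒0≤y-x (q≤1 N)))
        (solve 2 (λ q a → q :- q :* (con 1ℚ :- a) :+ a :* (con 1ℚ :- q) := a) refl (q N) (K * u N))))
      K*u<ε

  C-limit-isC : IsC k C-limit
  C-limit-isC = seq⟶ C-limit

  0<C-limit : fromℚ 0ℚ <ℝ C-limit
  -- Once `K * u N` is below 1, the lower end of the enclosure is positive and serves as the gap.
  0<C-limit = let N , K*u<1 = u-archimedean-* {K} (0<ι k) 0<1 in
    q N * (1ℚ - K * u N) , 0<* (0<q N) (x<y⇒0<y-x K*u<1) , suc N ,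
    λ n N<n → ≤-trans (≤-reflexive (+-identityˡ (q N * (1ℚ - K * u N)))) (q*[1-K*u]≤C-partial {N} {n} N<n)

  C-limit<1 : C-limit <ℝ fromℚ 1ℚ
  -- `q 1` consists of the factor at 2 alone, and later partial products stay below it.
  C-limit<1 = 1ℚ - q 1 , x<y⇒0<y-x q1<1 , 2 ,
    λ n 2≤n → ≤-by (x≤y⇒0≤y-x (C-partial≤q {1} {n} 2≤n))
      (solve 2 (λ a b → a :+ (con 1ℚ :- b) :+ (b :- a) := con 1ℚ) refl (C-partial k n) (q 1))
    where
    q1<1 : q 1 < 1ℚ
    q1<1 = subst (_< 1ℚ) (sym (*-identityˡ _)) (C<1 2 (from-yes (prime? 2)))

-- Telescoping steps and comparison factors for f_k.

-- If E bounds the product over p < x, the invariant E ≤ 2 (x - 2)/(x - 1) survives a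
-- factor 1 + 1/(x (x - 1)), which is below (x - 1)²/(x (x - 2)).
upper-step : ∀ {x E e} → 1ℚ < x → 0ℚ ≤ E → e * (x ^ 1 * (x - 1ℚ)) ≤ x ^ 1 * (x - 1ℚ) + 1ℚ →
             E * (x - 1ℚ) ≤ ι 2 * (x - ι 2) →
             E * e * (x + 1ℚ - 1ℚ) ≤ ι 2 * (x + 1ℚ - ι 2)
upper-step {x} {E} {e} 1<x 0≤E e-bound E-bound = *-cancelˡ-≤ (0<* 0<y 0<y) (≤-by
  (+-mono-≤ (+-mono-≤ 0≤2
    (0≤* (<⇒≤ 0<V+1) (x≤y⇒0≤y-x E-bound)))
    (0≤* (0≤* 0≤E (<⇒≤ 0<y)) (x≤y⇒0≤y-x e-bound)))
  (solve 3 (λ x E e →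
    let y = x :- con 1ℚ ; V = x :* con 1ℚ :* y in
    y :* y :* (E :* e :* (x :+ con 1ℚ :- con 1ℚ)) :+
      (con (ι 2) :+ (V :+ con 1ℚ) :* (con (ι 2) :* (x :- con (ι 2)) :- E :* y)
        :+ E :* y :* (V :+ con 1ℚ :- e :* V)) :=
    y :* y :* (con (ι 2) :* (x :+ con 1ℚ :- con (ι 2)))) refl x E e))
  where
  0≤2 = from-yes (0ℚ ≤? ι 2)
  0<y = x<y⇒0<y-x 1<x
  0<V+1 : 0ℚ < x ^ 1 * (x - 1ℚ) + 1ℚ
  0<V+1 = +-mono-< (0<* (1≤⇒>0 (1≤^ (<⇒≤ 1<x) 1)) 0<y) 0<1

-- Likewise G ≥ ⅔ x/(x - 1) survives a factor of at least 1 - 1/x².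
lower-step : ∀ {x G g} → 1ℚ < x → 0ℚ ≤ G → x ^ 2 - 1ℚ ≤ g * x ^ 2 →
             ι 2 * x ≤ ι 3 * (G * (x - 1ℚ)) →
             ι 2 * (x + 1ℚ) ≤ ι 3 * (G * g * (x + 1ℚ - 1ℚ))
lower-step {x} {G} {g} 1<x 0≤G g-bound G-bound = *-cancelˡ-≤ (0<* 0<x 0<y) (≤-by
  (+-mono-≤
    (0≤* (0≤* 0≤3 (0≤* 0≤G (<⇒≤ 0<y))) (x≤y⇒0≤y-x g-bound))
    (0≤* (x≤y⇒0≤y-x (1≤^ (<⇒≤ 1<x) 2)) (x≤y⇒0≤y-x G-bound)))
  (solve 3 (λ x G g →
    let y = x :- con 1ℚ ; x² = x :* (x :* con 1ℚ) in
    x :* y :* (con (ι 2) :* (x :+ con 1ℚ)) :+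
      (con (ι 3) :* (G :* y) :* (g :* x² :- (x² :- con 1ℚ))
        :+ (x² :- con 1ℚ) :* (con (ι 3) :* (G :* y) :- con (ι 2) :* x)) :=
    x :* y :* (con (ι 3) :* (G :* g :* (x :+ con 1ℚ :- con 1ℚ)))) refl x G g))
  where
  0≤3 = from-yes (0ℚ ≤? ι 3)
  0<x = <-trans 0<1 1<x
  0<y = x<y⇒0<y-x 1<x

module _ (p : ℕ) .{{_ : ℕ.NonTrivial p}} where

  upper-factor*V : upper-factor p * V p 1 ≡ V p 1 + 1ℚ
  upper-factor*V = trans
    (solve 2 (λ v r → (con 1ℚ :+ r) :* v := v :+ v :* r) refl (V p 1) (1/V p 1))
    (cong (λ z → V p 1 + z) (V*1/V p 1))

  1≤upper-factor : 1ℚ ≤ upper-factor p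
  1≤upper-factor = ≤-by (<⇒≤ (0<1/V p 1)) refl

  -- Weakens the loss 1/(p²(p-1)) to 1/p², the form that `lower-step` telescopes.
  p²-1≤lower-factor*p² : ι p ^ 2 - 1ℚ ≤ lower-factor p * ι p ^ 2
  p²-1≤lower-factor*p² = ≤-by
    (0≤* (0≤* (<⇒≤ (1≤⇒>0 (1≤^ (1≤ι p) 2))) (x≤y⇒0≤y-x {1ℚ} {ι p - 1ℚ} (+-monoˡ-≤ (- 1ℚ) (2≤ι p)))) (<⇒≤ (0<1/V p 2)))
    (begin
    X - 1ℚ + X * (ι p - 1ℚ - 1ℚ) * r        ≡⟨ cong (λ z → X - z + X * (ι p - 1ℚ - 1ℚ) * r) (V*1/V p 2) ⟨
    X - X * (ι p - 1ℚ) * r + X * (ι p - 1ℚ - 1ℚ) * r  ≡⟨ solve 3 (λ x X r →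
      X :- X :* (x :- con 1ℚ) :* r :+ X :* (x :- con 1ℚ :- con 1ℚ) :* r :=
      (con 1ℚ :- r) :* X) refl (ι p) X r ⟩
    (1ℚ - r) * X                            ∎)
    where
    open ≡-Reasoning
    X = ι p ^ 2
    r = 1/V p 2

  0<lower-factor : 0ℚ < lower-factor p
  0<lower-factor = *-cancelˡ-< 0<X (begin-strict
    ι p ^ 2 * 0ℚ               ≡⟨ *-zeroʳ (ι p ^ 2) ⟩
    0ℚ                         <⟨ x<y⇒0<y-x (<-≤-trans (from-yes (1ℚ <? ι 2)) (≤-trans (2≤ι p)
      (≤-trans (≤-reflexive (sym (*-identityʳ (ι p)))) (^-monoʳ-≤ (1≤ι p) {1} {2} (s≤s z≤n))))) ⟩
    ι p ^ 2 - 1ℚ               ≤⟨ p²-1≤lower-factor*p² ⟩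
    lower-factor p * ι p ^ 2   ≡⟨ *-comm (lower-factor p) (ι p ^ 2) ⟩
    ι p ^ 2 * lower-factor p   ∎)
    where
    open ≤-Reasoning
    0<X = 1≤⇒>0 (1≤^ (1≤ι p) 2)

  lower-factor≤1 : lower-factor p ≤ 1ℚ
  lower-factor≤1 = ≤-by (<⇒≤ (0<1/V p 2))
    (solve 1 (λ r → con 1ℚ :- r :+ r := con 1ℚ) refl (1/V p 2))

  1≤f-factor-even : ∀ {k} → (- 1ℚ) ^ k ≡ 1ℚ → 1ℚ ≤ f-factor p k
  1≤f-factor-even {k} even = ≤-by (<⇒≤ (0<1/W p k)) (sym (f-factor-even p {k} even))

  f-factor-even≤upper : ∀ {k} → 2 ℕ.≤ k → (- 1ℚ) ^ k ≡ 1ℚ → f-factor p k ≤ upper-factor p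
  f-factor-even≤upper {k} 2≤k even = subst (_≤ upper-factor p) (sym (f-factor-even p {k} even))
    (+-monoʳ-≤ 1ℚ (1/W≤1/V p {1} {k} 2≤k))

  f-factor-odd≤1 : ∀ {k} → (- 1ℚ) ^ k ≡ - 1ℚ → f-factor p k ≤ 1ℚ
  f-factor-odd≤1 {k} odd = ≤-by (<⇒≤ (0<1/W p k)) (trans (cong (_+ 1/W p k) (f-factor-odd p {k} odd))
    (solve 1 (λ r → con 1ℚ :- r :+ r := con 1ℚ) refl (1/W p k)))

  lower≤f-factor-odd : ∀ {k} → 3 ℕ.≤ k → (- 1ℚ) ^ k ≡ - 1ℚ → lower-factor p ≤ f-factor p k
  lower≤f-factor-odd {k} 3≤k odd = subst (lower-factor p ≤_) (sym (f-factor-odd p {k} odd))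
    (+-monoʳ-≤ 1ℚ (neg-antimono-≤ (1/W≤1/V p {2} {k} 3≤k)))

-- Products of the comparison factors over the primes.

private
  U L : ∀ p → Prime p → ℚ
  U p pr = upper-factor p {{prime⇒nonTrivial pr}}
  L p pr = lower-factor p {{prime⇒nonTrivial pr}}

upper lower : ℕ → ℚ
upper n = ∏< n prime? U
lower n = ∏< n prime? L

private
  1≤U : ∀ p (pr : Prime p) → 1ℚ ≤ U p pr
  1≤U p pr = 1≤upper-factor p {{prime⇒nonTrivial pr}}

  0<L : ∀ p (pr : Prime p) → 0ℚ < L p pr
  0<L p pr = 0<lower-factor p {{prime⇒nonTrivial pr}}

  L≤1 : ∀ p (pr : Prime p) → L p pr ≤ 1ℚ
  L≤1 p pr = lower-factor≤1 p {{prime⇒nonTrivial pr}}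

  1<ι[+30] : ∀ m → 1ℚ < ι (m ℕ.+ 30)
  1<ι[+30] m = <-≤-trans (from-yes (1ℚ <? ι 30)) (ι-mono-≤ (ℕ.m≤n+m 30 m))

-- The product over all primes is about 1.944 for upper and 0.698 for lower.  At 30 the
-- partial products leave enough room for the telescoping estimate of the tail.
upper-tail : ∀ m → upper (m ℕ.+ 30) * (ι (m ℕ.+ 30) - 1ℚ) ≤ ι 2 * (ι (m ℕ.+ 30) - ι 2)
upper-tail zero = from-yes (upper 30 * (ι 30 - 1ℚ) ≤? ι 2 * (ι 30 - ι 2))
upper-tail (suc m) = subst (λ z → upper (suc n) * (z - 1ℚ) ≤ ι 2 * (z - ι 2)) (sym (ι-suc n))
  (upper-step {x} {upper n} (1<ι[+30] m) (≤-trans 0≤1 (1≤∏< prime? 1≤U n))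
    (factorIf-elim (λ e → e * v ≤ v + 1ℚ) (prime? n)
      (λ pr → ≤-reflexive (upper-factor*V n {{prime⇒nonTrivial pr}}))
      (≤-by 0≤1 (cong (_+ 1ℚ) (*-identityˡ v))))
    (upper-tail m))
  where
  n = m ℕ.+ 30
  x = ι n
  v = x ^ 1 * (x - 1ℚ)

lower-tail : ∀ m → ι 2 * ι (m ℕ.+ 30) ≤ ι 3 * (lower (m ℕ.+ 30) * (ι (m ℕ.+ 30) - 1ℚ))
lower-tail zero = from-yes (ι 2 * ι 30 ≤? ι 3 * (lower 30 * (ι 30 - 1ℚ)))
lower-tail (suc m) = subst (λ z → ι 2 * z ≤ ι 3 * (lower (suc n) * (z - 1ℚ))) (sym (ι-suc n))
  (lower-step {x} {lower n} (1<ι[+30] m) (<⇒≤ (0<∏< prime? 0<L n))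
    (factorIf-elim (λ g → x ^ 2 - 1ℚ ≤ g * x ^ 2) (prime? n)
      (λ pr → p²-1≤lower-factor*p² n {{prime⇒nonTrivial pr}})
      (≤-by 0≤1 (solve 1 (λ X → X :- con 1ℚ :+ con 1ℚ := con 1ℚ :* X) refl (x ^ 2))))
    (lower-tail m))
  where
  n = m ℕ.+ 30
  x = ι n

upper-mono : ∀ n j → upper n ≤ upper (j ℕ.+ n)
upper-mono n zero    = ≤-refl
upper-mono n (suc j) = ≤-trans (upper-mono n j)
  (∏<-suc-≥ prime? (λ p pr → 1≤⇒>0 (1≤U p pr)) 1≤U (j ℕ.+ n))

lower-antitone : ∀ n j → lower (j ℕ.+ n) ≤ lower n
lower-antitone n zero    = ≤-refl
lower-antitone n (suc j) = ≤-trans (∏<-suc-≤ prime? 0<L L≤1 (j ℕ.+ n)) (lower-antitone n j)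

-- Monotonicity passes from n to n + 30, where the tail invariant holds; strictness comes from x - 2
-- < x - 1.
upper<2 : ∀ n → upper n < ι 2
upper<2 n = ≤-<-trans
  (subst (λ m → upper n ≤ upper m) (ℕ.+-comm 30 n) (upper-mono n 30))
  (*-cancelˡ-< 0<y (begin-strict
    y * upper m          ≡⟨ *-comm y (upper m) ⟩
    upper m * y          ≤⟨ upper-tail n ⟩
    ι 2 * (x - ι 2)      <⟨ <-by (from-yes (0ℚ <? ι 2)) (solve 1 (λ x →
      con (ι 2) :* (x :- con (ι 2)) :+ con (ι 2) := (x :- con 1ℚ) :* con (ι 2)) refl x) ⟩
    y * ι 2              ∎))
  where
  open ≤-Reasoning
  m = n ℕ.+ 30
  x = ι m
  y = x - 1ℚ
  0<y = x<y⇒0<y-x (1<ι[+30] n)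

-- The same shift by 30 applies; here strictness comes from 2(x-1) < 2x.
2/3<lower : ∀ n → + 2 / 3 < lower n
2/3<lower n = <-≤-trans
  (*-cancelˡ-< {ι 3 * y} (0<* (from-yes (0ℚ <? ι 3)) 0<y) (begin-strict
    ι 3 * y * (+ 2 / 3)    <⟨ <-by (from-yes (0ℚ <? ι 2)) (solve 1 (λ x →
      con (ι 3) :* (x :- con 1ℚ) :* con (+ 2 / 3) :+ con (ι 2) := con (ι 2) :* x) refl x) ⟩
    ι 2 * x                ≤⟨ lower-tail n ⟩
    ι 3 * (lower m * y)    ≡⟨ solve 2 (λ y l → con (ι 3) :* (l :* y) := con (ι 3) :* y :* l) refl y (lower m) ⟩
    ι 3 * y * lower m      ∎))
  (subst (λ m → lower m ≤ lower n) (ℕ.+-comm 30 n) (lower-antitone n 30))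
  where
  open ≤-Reasoning
  m = n ℕ.+ 30
  x = ι m
  y = x - 1ℚ
  0<y = x<y⇒0<y-x (1<ι[+30] n)

-- Bounds for f_k by the parity of k.

odd⇒3≤ : ∀ {k} → 2 ℕ.≤ k → (- 1ℚ) ^ k ≡ - 1ℚ → 3 ℕ.≤ k
odd⇒3≤ {1} (s≤s ()) odd
odd⇒3≤ {2} _ ()
odd⇒3≤ {suc (suc (suc k))} _ _ = s≤s (s≤s (s≤s z≤n))

module _ (k n : ℕ) .{{_ : ℕ.NonZero n}} (2≤k : 2 ℕ.≤ k) where

  private
    P? : Decidable (λ p → Prime p × p ∣ n)
    P? p = prime? p ×-dec p ∣? n

    F : ∀ p → Prime p × p ∣ n → ℚ
    F p (pr , _) = f-factor p {{prime⇒nonTrivial pr}} k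

  -- All factors are at least 1, which settles the lower bound. For the upper one, the product grows
  -- when its factors are enlarged and its range is extended to all primes up to n.
  f-even-bounds : (- 1ℚ) ^ k ≡ 1ℚ → + 2 / 3 < f k n × f k n < + 2 / 1
  f-even-bounds even =
    <-≤-trans (from-yes (+ 2 / 3 <? 1ℚ)) (1≤∏< P? {F} 1≤F (suc n)) ,
    ≤-<-trans (∏<-mono P? prime? {F} {U} (λ p pr → 1≤⇒>0 (1≤F p pr)) F≤U (suc n)) (upper<2 (suc n))
    where
    1≤F : ∀ p (pr : Prime p × p ∣ n) → 1ℚ ≤ F p pr
    1≤F p (pr , _) = 1≤f-factor-even p {{prime⇒nonTrivial pr}} {k} even
    F≤U : ∀ p → factorIf (P? p) (F p) ≤ factorIf (prime? p) (U p)
    F≤U p = factorIf-mono (P? p) (prime? p)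
      (λ (pr , _) pr′ → f-factor-even≤upper p {{prime⇒nonTrivial pr}} {k} 2≤k even)
      (λ (pr , _) ¬pr → contradiction pr ¬pr)
      (λ pr _ → 1≤U p pr)

  -- All factors are at most 1, so the roles are reversed: passing to all primes up to n only
  -- shrinks the product.
  f-odd-bounds : (- 1ℚ) ^ k ≡ - 1ℚ → + 2 / 3 < f k n × f k n < + 2 / 1
  f-odd-bounds odd =
    <-≤-trans (2/3<lower (suc n)) (∏<-mono prime? P? {L} {F} 0<L L≤F (suc n)) ,
    ≤-<-trans (∏<≤1 P? {F} 0<F F≤1 (suc n)) (from-yes (1ℚ <? + 2 / 1))
    where
    lower≤F : ∀ p (pr : Prime p × p ∣ n) → L p (proj₁ pr) ≤ F p pr
    lower≤F p (pr , _) = lower≤f-factor-odd p {{prime⇒nonTrivial pr}} {k} (odd⇒3≤ 2≤k odd) odd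
    0<F : ∀ p (pr : Prime p × p ∣ n) → 0ℚ < F p pr
    0<F p pr = <-≤-trans (0<L p (proj₁ pr)) (lower≤F p pr)
    F≤1 : ∀ p (pr : Prime p × p ∣ n) → F p pr ≤ 1ℚ
    F≤1 p (pr , _) = f-factor-odd≤1 p {{prime⇒nonTrivial pr}} {k} odd
    L≤F : ∀ p → factorIf (prime? p) (L p) ≤ factorIf (P? p) (F p)
    L≤F p = factorIf-mono (prime? p) (P? p)
      (λ _ pr → lower≤F p pr)
      (λ pr _ → L≤1 p pr)
      (λ (pr , _) ¬pr → contradiction pr ¬pr)

  f-bounds : + 2 / 3 < f k n × f k n < + 2 / 1
  f-bounds = [ f-even-bounds , f-odd-bounds ]′ (-1^k≡±1 k)

theorem3 : (∀ k → 2 ℕ.≤ k → ∃[ c ] (IsC k c × fromℚ 0ℚ <ℝ c × c <ℝ fromℚ 1ℚ))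
    × (∀ k → 2 ℕ.≤ k → ∀ n → .{{_ : ℕ.NonZero n}} → + 2 / 3 < f k n × f k n < + 2 / 1)
theorem3 =
  (λ k 2≤k → C-limit 2≤k , C-limit-isC 2≤k , 0<C-limit 2≤k , C-limit<1 2≤k) ,
  (λ k 2≤k n → f-bounds k n 2≤k)
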